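{- Let $\Gamma$ be the embedded graph with vertices $v,u_1,u_2,u_3$ and the following nine edges: for each $i\in\{1,2,3\}$ an edge $b_i$ joining $u_i$ and $v$, and two loops $\ell_i, m_i$ at $u_i$; the rotation system is given by the cyclic orders $\pi_v=(b_1\,b_2\,b_3)$ and $\pi_{u_i}=(b_i\,\ell_i\,m_i\,\ell_i\,m_i)$ for $i=1,2,3$. Then $\Gamma$ admits a nowhere-identity $D_6$-flow, but $\Gamma$ does not admit a nowhere-identity dihedral $3$-flow. In particular, the statement "an embedded graph admits a nowhere-identity $D_{2n}$-flow if and only if it admits a nowhere-identity dihedral $n$-flow" is false for $n=3$.
   Context: Graphs are finite and connected and may have loops and parallel edges. An embedded graph is a graph $\Gamma=(V,E)$ with a rotation system $\pi=\{\pi_v\mid v\in V\}$, where $\pi_v$ is a cyclic order of the edges incident with $v$ (a loop at $v$ appears twice, once for each of its ends); this is equivalent to a cellular embedding of $\Gamma$ in a closed connected orientable surface. For a group $G$ and an orientation of the edges, a $G$-flow is a map $f:E\to G$ such that at each vertex $v$ the product of the values of the incident edges, taken in the order $\pi_v$, is the identity, where the inverse $f(e)^{ -1}$ is used for an edge leaving $v$ (so a loop contributes $f(e)$ at one end and $f(e)^{ -1}$ at the other). It is nowhere-identity if $f(e)\neq 1$ for all $e$. Existence of a nowhere-identity $G$-flow does not depend on the chosen orientation. $D_{2n}=\{\begin{pmatrix}\pm1&a\\0&1\end{pmatrix}\mid a\in\mathbb{Z}/n\mathbb{Z}\}$ is the dihedral group of order $2n$. Let $\mathbb{D}=\{\begin{pmatrix}\pm1&a\\0&1\end{pmatrix}\mid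 a\in\mathbb{Z}\}$ and $\mathbb{D}^{<n}=\{\begin{pmatrix}\pm1&a\\0&1\end{pmatrix}\in\mathbb{D}\mid |a|<n\}$. A nowhere-identity dihedral $n$-flow is a nowhere-identity $\mathbb{D}$-flow all of whose values lie in $\mathbb{D}^{<n}$. -}

module Defs where

open import Algebra.Bundles using (Group; AbelianGroup)
import Algebra.Properties.AbelianGroup as AbelianGroupProperties
import Algebra.Properties.Group as GroupProperties
open import Data.Bool.Base using (Bool; true; false; not; if_then_else_)
import Data.Bool.Properties as Bool
open import Data.Fin.Base using (Fin; suc)
open import Data.Fin.Patterns using (0F; 1F; 2F; 3F; 4F; 5F; 6F; 7F; 8F)
open import Data.Integer.Base using (ℤ; +_; _+_; _-_; -_; _*_; 0ℤ; ∣_∣)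
open import Data.Integer.Divisibility.Signed using (_∣_; divides)
open import Data.Integer.Properties using (+-0-abelianGroup)
open import Data.Integer.Tactic.RingSolver using (solve-∀)
open import Data.List.Base using (List; []; _∷_; map; foldr)
open import Data.List.Membership.Propositional using (_∈_)
open import Data.List.Relation.Unary.All using ([]; _∷_)
open import Data.List.Relation.Unary.AllPairs using ([]; _∷_)
open import Data.List.Relation.Unary.Any using (here; there)
open import Data.List.Relation.Unary.Unique.Propositional using (Unique)
open import Data.Nat.Base as ℕ using (ℕ)
open import Data.Product.Base using (_×_; _,_; ∃-syntax)
open import Data.Product.Relation.Binary.Pointwise.NonDependent
  using (Pointwise; ×-isEquivalence)
open import Data.Sign.Base as Sign using (Sign)
import Data.Sign.Properties as Sign
open import Data.Sum.Base using (_⊎_; inj₁; inj₂)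
open import Function.Bundles using (_↔_; _⇔_; mk⇔; mk↔ₛ′)
open import Level using (Level; _⊔_; 0ℓ)
open import Relation.Binary.Construct.Closure.ReflexiveTransitive
  using (Star; ε; _◅_; _◅◅_)
open import Relation.Binary.PropositionalEquality
  using (_≡_; refl; sym; trans; cong; cong₂; isEquivalence)
open import Relation.Nullary.Decidable using (does)
open import Relation.Nullary.Negation using (¬_)

------------------------------------------------------------------------
-- Embedded graphs

-- Every edge e has two ends (e , false) and (e , true); for a loop both
-- are attached to the same vertex. The labels only serve to tell the two
-- ends apart: they do not orient the edge.
--
-- The cyclic order at v is represented by the list π v, read from an
-- arbitrary starting point.
record EmbeddedGraph : Set₁ where
  field
    Vertex Edge   : Set
    ∣V∣ ∣E∣       : ℕ
    finiteV       : Vertex ↔ Fin ∣V∣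
    finiteE       : Edge ↔ Fin ∣E∣
    attach        : Edge → Bool → Vertex

  HalfEdge : Set
  HalfEdge = Edge × Bool

  Adjacent : Vertex → Vertex → Set
  Adjacent v w = ∃[ e ] ∃[ i ] attach e i ≡ v × attach e (not i) ≡ w

  field
    nonempty      : Vertex
    connected     : ∀ v w → Star Adjacent v w
    π             : Vertex → List HalfEdge
    π-unique      : ∀ v → Unique (π v)
    π-incident    : ∀ v e i → ((e , i) ∈ π v) ⇔ (attach e i ≡ v)

  -- Each edge is sent to the end at which it leaves, i.e. to its tail.
  Orientation : Set
  Orientation = Edge → Bool

------------------------------------------------------------------------
-- Flows

module _ {c ℓ : Level} (G : Group c ℓ) (Γ : EmbeddedGraph) where
  private module G = Group G
  open G using (Carrier; _≈_; _∙_; _⁻¹)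
  open EmbeddedGraph Γ

  contribution : Orientation → (Edge → Carrier) → HalfEdge → Carrier
  contribution o f (e , i) = if does (i Bool.≟ o e) then f e ⁻¹ else f e

  product : List Carrier → Carrier
  product = foldr _∙_ G.ε

  -- Rotating the list π v conjugates the product, so the condition
  -- depends only on the cyclic order.
  IsFlow : Orientation → (Edge → Carrier) → Set ℓ
  IsFlow o f = ∀ v → product (map (contribution o f) (π v)) ≈ G.ε

  NowhereIdentity : (Edge → Carrier) → Set ℓ
  NowhereIdentity f = ∀ e → ¬ (f e ≈ G.ε)

  AdmitsNowhereIdentityFlow : Set (c ⊔ ℓ)
  AdmitsNowhereIdentityFlow =
    ∃[ o ] ∃[ f ] IsFlow o f × NowhereIdentity f

  -- The choice of orientation is immaterial, also for flows with values in
  -- a subset closed under inverses.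
  reorient : ∀ o o′ f → IsFlow o f → NowhereIdentity f →
    ∃[ f′ ] IsFlow o′ f′ × NowhereIdentity f′ ×
            (∀ e → f′ e ≡ f e ⊎ f′ e ≡ f e ⁻¹)
  reorient o o′ f flow ni = f′ , flow′ , ni′ , f′-or
    where
    open GroupProperties G using (⁻¹-involutive; ε⁻¹≈ε)

    f′ : Edge → Carrier
    f′ e = if does (o e Bool.≟ o′ e) then f e else f e ⁻¹

    same : ∀ h → contribution o′ f′ h ≈ contribution o f h
    same (e , i) with i | o e | o′ e
    ... | false | false | false = G.refl
    ... | false | false | true  = G.refl
    ... | false | true  | false = ⁻¹-involutive (f e)
    ... | false | true  | true  = G.refl
    ... | true  | false | false = G.refl
    ... | true  | false | true  = ⁻¹-involutive (f e)
    ... | true  | true  | false = G.refl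
    ... | true  | true  | true  = G.refl

    same-product : ∀ hs → product (map (contribution o′ f′) hs)
                        ≈ product (map (contribution o f) hs)
    same-product []       = G.refl
    same-product (h ∷ hs) = G.∙-cong (same h) (same-product hs)

    flow′ : IsFlow o′ f′
    flow′ v = G.trans (same-product (π v)) (flow v)

    ni′ : NowhereIdentity f′
    ni′ e with does (o e Bool.≟ o′ e)
    ... | true  = ni e
    ... | false = λ p → ni e (G.trans (G.sym (⁻¹-involutive (f e)))
                             (G.trans (G.⁻¹-cong p) ε⁻¹≈ε))

    f′-or : ∀ e → f′ e ≡ f e ⊎ f′ e ≡ f e ⁻¹
    f′-or e with does (o e Bool.≟ o′ e)
    ... | true  = inj₁ refl
    ... | false = inj₂ refl

------------------------------------------------------------------------
-- Groups of matrices (±1 a ; 0 1)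

-- The pair (s , a) stands for the matrix with rows (s1 , a) and (0 , 1).
-- The operation is matrix multiplication:
--   (s1 a ; 0 1) (t1 b ; 0 1) = (st1 , s b + a ; 0 1).
-- Signs are compared formally, so that over ℤ/nℤ the group has order 2n also
-- for n ≤ 2, where 1 = -1.
module _ {c ℓ : Level} (A : AbelianGroup c ℓ) where
  private module A = AbelianGroup A
  open AbelianGroupProperties A using (⁻¹-∙-comm; ⁻¹-involutive; ε⁻¹≈ε)

  signed : Sign → A.Carrier → A.Carrier
  signed Sign.+ a = a
  signed Sign.- a = a A.⁻¹

  private
    signed-cong : ∀ s {a b} → a A.≈ b → signed s a A.≈ signed s b
    signed-cong Sign.+ p = p
    signed-cong Sign.- p = A.⁻¹-cong p

    signed-* : ∀ s t a → signed (s Sign.* t) a A.≈ signed s (signed t a)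
    signed-* Sign.+ t a = A.refl
    signed-* Sign.- Sign.+ a = A.refl
    signed-* Sign.- Sign.- a = A.sym (⁻¹-involutive a)

    signed-∙ : ∀ s a b → signed s (a A.∙ b) A.≈ signed s a A.∙ signed s b
    signed-∙ Sign.+ a b = A.refl
    signed-∙ Sign.- a b = A.sym (⁻¹-∙-comm a b)

    signed-ε : ∀ s → signed s A.ε A.≈ A.ε
    signed-ε Sign.+ = A.refl
    signed-ε Sign.- = ε⁻¹≈ε

    signed-inverse : ∀ s a → signed s (signed s a A.⁻¹) A.∙ a A.≈ A.ε
    signed-inverse Sign.+ a = A.inverseˡ a
    signed-inverse Sign.- a =
      A.trans (A.∙-congʳ (A.⁻¹-cong (⁻¹-involutive a))) (A.inverseˡ a)

  matrixGroup : Group c ℓ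
  matrixGroup = record
    { Carrier = Sign × A.Carrier
    ; _≈_     = Pointwise _≡_ A._≈_
    ; _∙_     = λ (s , a) (t , b) → (s Sign.* t) , (signed s b A.∙ a)
    ; ε       = Sign.+ , A.ε
    ; _⁻¹     = λ (s , a) → s , (signed s a A.⁻¹)
    ; isGroup = record
      { isMonoid = record
        { isSemigroup = record
          { isMagma = record
            { isEquivalence = ×-isEquivalence isEquivalence A.isEquivalence
            ; ∙-cong = λ { {s , _} (refl , p) (q , r) →
                cong (s Sign.*_) q , A.∙-cong (signed-cong s r) p }
            }
          ; assoc = λ (s , a) (t , b) (u , c) → Sign.*-assoc s t u ,
              A.trans (A.∙-congʳ (signed-* s t c))
              (A.trans (A.sym (A.assoc _ _ _))
              (A.∙-congʳ (A.sym (signed-∙ s (signed t c) b))))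
          }
        ; identity = (λ (s , a) → refl , A.identityʳ a)
                   , (λ (s , a) → Sign.*-identityʳ s ,
                        A.trans (A.∙-congʳ (signed-ε s)) (A.identityˡ a))
        }
      ; inverse = (λ (s , a) → Sign.s*s≡+ s , A.inverseʳ _)
                , (λ (s , a) → Sign.s*s≡+ s , signed-inverse s a)
      ; ⁻¹-cong = λ { {s , _} (refl , p) →
          refl , A.⁻¹-cong (signed-cong s p) }
      }
    }

------------------------------------------------------------------------
-- ℤ/nℤ, as ℤ with congruence modulo n

module _ (n : ℕ) where
  infix 4 _≋_

  _≋_ : ℤ → ℤ → Set
  a ≋ b = + n ∣ a - b

  private
    reflexive : ∀ {a b} → a ≡ b → a ≋ b
    reflexive {a} refl = divides 0ℤ (lemma a (+ n))
      where
      lemma : ∀ a k → a - a ≡ 0ℤ * k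
      lemma = solve-∀

    symmetric : ∀ {a b} → a ≋ b → b ≋ a
    symmetric {a} {b} (divides q eq) =
      divides (- q) (trans (lemma₁ a b) (trans (cong -_ eq) (lemma₂ q (+ n))))
      where
      lemma₁ : ∀ a b → b - a ≡ - (a - b)
      lemma₁ = solve-∀
      lemma₂ : ∀ q k → - (q * k) ≡ - q * k
      lemma₂ = solve-∀

    transitive : ∀ {a b c} → a ≋ b → b ≋ c → a ≋ c
    transitive {a} {b} {c} (divides q eq) (divides r eq′) = divides (q + r)
      (trans (lemma₁ a b c) (trans (cong₂ _+_ eq eq′) (lemma₂ q r (+ n))))
      where
      lemma₁ : ∀ a b c → a - c ≡ (a - b) + (b - c)
      lemma₁ = solve-∀
      lemma₂ : ∀ q r k → q * k + r * k ≡ (q + r) * k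
      lemma₂ = solve-∀

    +-cong : ∀ {a b c d} → a ≋ b → c ≋ d → a + c ≋ b + d
    +-cong {a} {b} {c} {d} (divides q eq) (divides r eq′) = divides (q + r)
      (trans (lemma₁ a b c d) (trans (cong₂ _+_ eq eq′) (lemma₂ q r (+ n))))
      where
      lemma₁ : ∀ a b c d → (a + c) - (b + d) ≡ (a - b) + (c - d)
      lemma₁ = solve-∀
      lemma₂ : ∀ q r k → q * k + r * k ≡ (q + r) * k
      lemma₂ = solve-∀

    neg-cong : ∀ {a b} → a ≋ b → - a ≋ - b
    neg-cong {a} {b} (divides q eq) =
      divides (- q) (trans (lemma₁ a b) (trans (cong -_ eq) (lemma₂ q (+ n))))
      where
      lemma₁ : ∀ a b → - a - - b ≡ - (a - b)
      lemma₁ = solve-∀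
      lemma₂ : ∀ q k → - (q * k) ≡ - q * k
      lemma₂ = solve-∀

  ℤ/ : AbelianGroup 0ℓ 0ℓ
  ℤ/ = record
    { Carrier = ℤ
    ; _≈_     = _≋_
    ; _∙_     = _+_
    ; ε       = 0ℤ
    ; _⁻¹     = -_
    ; isAbelianGroup = record
      { isGroup = record
        { isMonoid = record
          { isSemigroup = record
            { isMagma = record
              { isEquivalence = record
                { refl  = λ {a} → reflexive {a} refl
                ; sym   = λ {a} {b} → symmetric {a} {b}
                ; trans = λ {a} {b} {c} → transitive {a} {b} {c}
                }
              ; ∙-cong = λ {a} {b} {c} {d} → +-cong {a} {b} {c} {d}
              }
            ; assoc = λ a b c → reflexive (ℤ⁺.assoc a b c)
            }
          ; identity = (λ a → reflexive (ℤ⁺.identityˡ a))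
                     , (λ a → reflexive (ℤ⁺.identityʳ a))
          }
        ; inverse = (λ a → reflexive (ℤ⁺.inverseˡ a))
                  , (λ a → reflexive (ℤ⁺.inverseʳ a))
        ; ⁻¹-cong = λ {a} {b} → neg-cong {a} {b}
        }
      ; comm = λ a b → reflexive (ℤ⁺.comm a b)
      }
    }
    where module ℤ⁺ = AbelianGroup +-0-abelianGroup

------------------------------------------------------------------------
-- Dihedral flows

-- The dihedral group of order 2n, for n ≥ 1.
D[2·_] : ℕ → Group 0ℓ 0ℓ
D[2· n ] = matrixGroup (ℤ/ n)

𝔻 : Group 0ℓ 0ℓ
𝔻 = matrixGroup +-0-abelianGroup

𝔻^< : ℕ → Group.Carrier 𝔻 → Set
𝔻^< n (s , a) = ∣ a ∣ ℕ.< n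

AdmitsNowhereIdentityDihedralFlow : ℕ → EmbeddedGraph → Set
AdmitsNowhereIdentityDihedralFlow n Γ =
  ∃[ o ] ∃[ f ] IsFlow 𝔻 Γ o f × NowhereIdentity 𝔻 Γ f × (∀ e → 𝔻^< n (f e))

------------------------------------------------------------------------
-- The graph Γ

data VertexΓ : Set where
  v : VertexΓ
  u : Fin 3 → VertexΓ

data EdgeΓ : Set where
  b ℓ m : Fin 3 → EdgeΓ

attachΓ : EdgeΓ → Bool → VertexΓ
attachΓ (b i) false = u i
attachΓ (b i) true  = v
attachΓ (ℓ i) _     = u i
attachΓ (m i) _     = u i

πΓ : VertexΓ → List (EdgeΓ × Bool)
πΓ v     = (b 0F , true) ∷ (b 1F , true) ∷ (b 2F , true) ∷ []
πΓ (u i) = (b i , false) ∷ (ℓ i , false) ∷ (m i , false)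
         ∷ (ℓ i , true)  ∷ (m i , true)  ∷ []

Γ : EmbeddedGraph
Γ = record
  { Vertex     = VertexΓ
  ; Edge       = EdgeΓ
  ; ∣V∣        = 4
  ; ∣E∣        = 9
  ; finiteV    = mk↔ₛ′ toV fromV toV∘fromV fromV∘toV
  ; finiteE    = mk↔ₛ′ toE fromE toE∘fromE fromE∘toE
  ; attach     = attachΓ
  ; nonempty   = v
  ; connected  = λ x y → toCentre x ◅◅ fromCentre y
  ; π          = πΓ
  ; π-unique   = unique
  ; π-incident = λ x e i → mk⇔ (incident⇒ x) (incident⇐ x e i)
  }
  where
  toV : VertexΓ → Fin 4
  toV v     = 0F
  toV (u i) = suc i

  fromV : Fin 4 → VertexΓ
  fromV 0F      = v
  fromV (suc i) = u i

  toV∘fromV : ∀ k → toV (fromV k) ≡ k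
  toV∘fromV 0F      = refl
  toV∘fromV (suc i) = refl

  fromV∘toV : ∀ x → fromV (toV x) ≡ x
  fromV∘toV v     = refl
  fromV∘toV (u i) = refl

  toE : EdgeΓ → Fin 9
  toE (b 0F) = 0F
  toE (b 1F) = 1F
  toE (b 2F) = 2F
  toE (ℓ 0F) = 3F
  toE (ℓ 1F) = 4F
  toE (ℓ 2F) = 5F
  toE (m 0F) = 6F
  toE (m 1F) = 7F
  toE (m 2F) = 8F

  fromE : Fin 9 → EdgeΓ
  fromE 0F = b 0F
  fromE 1F = b 1F
  fromE 2F = b 2F
  fromE 3F = ℓ 0F
  fromE 4F = ℓ 1F
  fromE 5F = ℓ 2F
  fromE 6F = m 0F
  fromE 7F = m 1F
  fromE 8F = m 2F

  toE∘fromE : ∀ k → toE (fromE k) ≡ k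
  toE∘fromE 0F = refl
  toE∘fromE 1F = refl
  toE∘fromE 2F = refl
  toE∘fromE 3F = refl
  toE∘fromE 4F = refl
  toE∘fromE 5F = refl
  toE∘fromE 6F = refl
  toE∘fromE 7F = refl
  toE∘fromE 8F = refl

  fromE∘toE : ∀ e → fromE (toE e) ≡ e
  fromE∘toE (b 0F) = refl
  fromE∘toE (b 1F) = refl
  fromE∘toE (b 2F) = refl
  fromE∘toE (ℓ 0F) = refl
  fromE∘toE (ℓ 1F) = refl
  fromE∘toE (ℓ 2F) = refl
  fromE∘toE (m 0F) = refl
  fromE∘toE (m 1F) = refl
  fromE∘toE (m 2F) = refl

  Adj : VertexΓ → VertexΓ → Set
  Adj x y = ∃[ e ] ∃[ i ] attachΓ e i ≡ x × attachΓ e (not i) ≡ y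

  toCentre : ∀ x → Star Adj x v
  toCentre v     = ε
  toCentre (u i) = (b i , false , refl , refl) ◅ ε

  fromCentre : ∀ x → Star Adj v x
  fromCentre v     = ε
  fromCentre (u i) = (b i , true , refl , refl) ◅ ε

  unique : ∀ x → Unique (πΓ x)
  unique v     = ((λ ()) ∷ (λ ()) ∷ []) ∷ ((λ ()) ∷ []) ∷ [] ∷ []
  unique (u i) = ((λ ()) ∷ (λ ()) ∷ (λ ()) ∷ (λ ()) ∷ [])
               ∷ ((λ ()) ∷ (λ ()) ∷ (λ ()) ∷ [])
               ∷ ((λ ()) ∷ (λ ()) ∷ [])
               ∷ ((λ ()) ∷ [])
               ∷ [] ∷ []

  incident⇒ : ∀ x {e i} → (e , i) ∈ πΓ x → attachΓ e i ≡ x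
  incident⇒ v (here refl)                                  = refl
  incident⇒ v (there (here refl))                          = refl
  incident⇒ v (there (there (here refl)))                  = refl
  incident⇒ (u _) (here refl)                              = refl
  incident⇒ (u _) (there (here refl))                      = refl
  incident⇒ (u _) (there (there (here refl)))              = refl
  incident⇒ (u _) (there (there (there (here refl))))      = refl
  incident⇒ (u _) (there (there (there (there (here refl))))) = refl

  incident⇐ : ∀ x e i → attachΓ e i ≡ x → (e , i) ∈ πΓ x
  incident⇐ _ (b i)  false refl = here refl
  incident⇐ _ (b 0F) true  refl = here refl
  incident⇐ _ (b 1F) true  refl = there (here refl)
  incident⇐ _ (b 2F) true  refl = there (there (here refl))
  incident⇐ _ (ℓ i)  false refl = there (here refl)
  incident⇐ _ (ℓ i)  true  refl = there (there (there (here refl)))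
  incident⇐ _ (m i)  false refl = there (there (here refl))
  incident⇐ _ (m i)  true  refl = there (there (there (there (here refl))))

{-# OPTIONS --safe #-}

-- The equation at uᵢ makes the value of bᵢ a commutator up to inversion, and
-- commutators in 𝔻 are translations by even integers. In 𝔻^< 3 the only such
-- non-identity elements are the translations by ±2, and ±2 ± 2 ± 2 ≠ 0, which
-- contradicts the equation at v. Modulo 3, however, 2 + 2 + 2 = 0.
module Submission where

open import Algebra.Bundles using (Group)
import Algebra.Properties.Group as GroupProperties
open import Data.Bool.Base using (true; false)
open import Data.Fin.Patterns using (0F; 1F; 2F)
open import Data.Integer.Base using (ℤ; +_; -[1+_]; _+_; -_; _*_; 0ℤ; 1ℤ; ∣_∣)
open import Data.Integer.Divisibility.Signed using (divides; _∣?_)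
open import Data.Integer.Properties using (∣-i∣≡∣i∣; neg-involutive)
open import Data.Integer.Tactic.RingSolver using (solve-∀)
open import Data.Nat.Base as ℕ using (s≤s)
open import Data.Product.Base using (_×_; _,_; ∃-syntax; proj₁)
open import Data.Sign.Base as Sign using (Sign)
open import Data.Sum.Base using (_⊎_; inj₁; inj₂)
open import Function.Bundles using (_⇔_; Equivalence)
open import Relation.Binary.PropositionalEquality
  using (_≡_; refl; sym; cong; subst)
open import Relation.Nullary.Decidable using (from-no)
open import Relation.Nullary.Negation using (¬_; contradiction)
open import Defs

module _ {c r} (G : Group c r) (Δ : EmbeddedGraph) where
  open Group G renaming (refl to ≈-refl; sym to ≈-sym)
  open GroupProperties G using (⁻¹-involutive)
  open EmbeddedGraph Δ

  -- Whichever end is the tail, one end carries `f e` and the other its inverse. This makes the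
  -- product of the loops at each `u i` a commutator for every orientation.
  contribution-opposite : ∀ o f e →
    contribution G Δ o f (e , true) ≈ contribution G Δ o f (e , false) ⁻¹
  contribution-opposite o f e with o e
  ... | true  = ≈-refl
  ... | false = ≈-sym (⁻¹-involutive (f e))

  -- Transfers the size bound and being different from the identity from `f` to its contributions,
  -- so that the orientation never has to be fixed.
  contribution-preserves : ∀ {p} {P : Carrier → Set p} →
    (∀ {g} → P g → P (g ⁻¹)) →
    ∀ o f h → P (f (proj₁ h)) → P (contribution G Δ o f h)
  contribution-preserves inv o f (e , i) Pfe with i | o e
  ... | true  | true  = inv Pfe
  ... | true  | false = Pfe
  ... | false | true  = Pfe
  ... | false | false = inv Pfe

open Group 𝔻 using (_≈_; _∙_; _⁻¹; ∙-cong; ∙-congˡ; ∙-congʳ; ⁻¹-cong)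
  renaming (Carrier to ∣𝔻∣; ε to 1𝔻; refl to ≈-refl; sym to ≈-sym; trans to ≈-trans)
open GroupProperties 𝔻 using (⁻¹-involutive; ε⁻¹≈ε; inverseʳ-unique)

IsEvenTranslation : ∣𝔻∣ → Set
IsEvenTranslation g = ∃[ k ] g ≈ (Sign.+ , k * + 2)

-- For signs `s`, `t` and entries `a`, `c`, the products `x ∙ y` and `y ∙ x` agree in sign, and
-- their entries differ by `(1 - t) * a - (1 - s) * c`; half of this is the witness in each case.
-- The final `1𝔻` is the one that `foldr` leaves.
commutator-even : ∀ x y → IsEvenTranslation (x ∙ (y ∙ (x ⁻¹ ∙ (y ⁻¹ ∙ 1𝔻))))
commutator-even (Sign.+ , a) (Sign.+ , c) = 0ℤ , refl , lemma a c
  where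
  lemma : ∀ a c → 0ℤ + - c + - a + c + a ≡ 0ℤ * + 2
  lemma = solve-∀
commutator-even (Sign.+ , a) (Sign.- , c) = a , refl , lemma a c
  where
  lemma : ∀ a c → - (- 0ℤ + - - c + - a) + c + a ≡ a * + 2
  lemma = solve-∀
commutator-even (Sign.- , a) (Sign.+ , c) = - c , refl , lemma a c
  where
  lemma : ∀ a c → - (- (0ℤ + - c) + - - a + c) + a ≡ - c * + 2
  lemma = solve-∀
commutator-even (Sign.- , a) (Sign.- , c) = a + - c , refl , lemma a c
  where
  lemma : ∀ a c → - (- (- (- 0ℤ + - - c) + - - a) + c) + a ≡ (a + - c) * + 2
  lemma = solve-∀

𝔻^<-⁻¹ : ∀ {n} g → 𝔻^< n g → 𝔻^< n (g ⁻¹)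
𝔻^<-⁻¹ {n} (Sign.+ , a) = subst (ℕ._< n) (sym (∣-i∣≡∣i∣ a))
-- A reflection is its own inverse, computed here with entry `- - a`.
𝔻^<-⁻¹ {n} (Sign.- , a) = subst (ℕ._< n) (cong ∣_∣ (sym (neg-involutive a)))

≉1-⁻¹ : ∀ {g} → ¬ g ≈ 1𝔻 → ¬ g ⁻¹ ≈ 1𝔻
≉1-⁻¹ {g} g≉1 p =
  g≉1 (≈-trans (≈-sym (⁻¹-involutive g)) (≈-trans (⁻¹-cong p) ε⁻¹≈ε))

IsDoubleStep : ∣𝔻∣ → Set
IsDoubleStep g = g ≈ (Sign.+ , + 2) ⊎ g ≈ (Sign.+ , - + 2)

small-even : ∀ {g} → 𝔻^< 3 g → ¬ g ≈ 1𝔻 → IsEvenTranslation g → IsDoubleStep g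
small-even _ g≉1 (+ 0 , p)           = contradiction p g≉1
small-even _ _   (+ 1 , p)           = inj₁ p
small-even _ _   (-[1+ 0 ] , p)      = inj₂ p
-- The remaining multiples of 2 have absolute value at least 4.
small-even (s≤s (s≤s (s≤s ()))) _ (+ ℕ.suc (ℕ.suc _) , refl , refl)
small-even (s≤s (s≤s (s≤s ()))) _ (-[1+ ℕ.suc _ ] , refl , refl)

-- The entry of the product is twice a sum of three terms `±1`, which is odd and hence nonzero.
three-double-steps : ∀ {x y z} → IsDoubleStep x → IsDoubleStep y → IsDoubleStep z →
                     ¬ x ∙ (y ∙ (z ∙ 1𝔻)) ≈ 1𝔻
three-double-steps (inj₁ (refl , refl)) (inj₁ (refl , refl)) (inj₁ (refl , refl)) ()
three-double-steps (inj₁ (refl , refl)) (inj₁ (refl , refl)) (inj₂ (refl , refl)) ()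
three-double-steps (inj₁ (refl , refl)) (inj₂ (refl , refl)) (inj₁ (refl , refl)) ()
three-double-steps (inj₁ (refl , refl)) (inj₂ (refl , refl)) (inj₂ (refl , refl)) ()
three-double-steps (inj₂ (refl , refl)) (inj₁ (refl , refl)) (inj₁ (refl , refl)) ()
three-double-steps (inj₂ (refl , refl)) (inj₁ (refl , refl)) (inj₂ (refl , refl)) ()
three-double-steps (inj₂ (refl , refl)) (inj₂ (refl , refl)) (inj₁ (refl , refl)) ()
three-double-steps (inj₂ (refl , refl)) (inj₂ (refl , refl)) (inj₂ (refl , refl)) ()

D₆-flow : AdmitsNowhereIdentityFlow D[2· 3 ] Γ
D₆-flow = (λ _ → true) , f , flow , nowhere-identity
  where
  f : EdgeΓ → Sign × ℤ
  -- The commutator of the values on `ℓ` and `m` is the translation by -2, which cancels this value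
  -- at `u`.
  f (b _) = Sign.+ , + 2
  f (ℓ _) = Sign.- , 0ℤ
  f (m _) = Sign.+ , 1ℤ

  flow : IsFlow D[2· 3 ] Γ (λ _ → true) f
  -- All three edges leave `v`, so the entry is -6 = -2 * 3; at `u` it is 0 already over the
  -- integers.
  flow v     = refl , divides (- + 2) refl
  flow (u _) = refl , divides 0ℤ refl

  nowhere-identity : NowhereIdentity D[2· 3 ] Γ f
  -- On `ℓ` the sign alone excludes the identity.
  nowhere-identity (b _) (_ , 3∣2) = from-no (+ 3 ∣? + 2) 3∣2
  nowhere-identity (m _) (_ , 3∣1) = from-no (+ 3 ∣? 1ℤ) 3∣1

no-dihedral-3-flow : ¬ AdmitsNowhereIdentityDihedralFlow 3 Γ
no-dihedral-3-flow (o , f , flow , f≉1 , f<3) =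
  three-double-steps (double-step 0F) (double-step 1F) (double-step 2F) (flow v)
  where
  φ : EdgeΓ × _ → ∣𝔻∣
  φ = contribution 𝔻 Γ o f

  opposite : ∀ e → φ (e , true) ≈ φ (e , false) ⁻¹
  opposite = contribution-opposite 𝔻 Γ o f

  even : ∀ i → IsEvenTranslation (φ (b i , true))
  even i =
    let x = φ (ℓ i , false)
        y = φ (m i , false)
        k , commutator≈ = commutator-even x y
        loops≈ = ∙-congˡ {x} (∙-congˡ {y}
                   (∙-cong (opposite (ℓ i)) (∙-congʳ {1𝔻} (opposite (m i)))))
    -- By the equation at `u i`, the loops multiply to the inverse of the contribution of `b i`
    -- there, which is its contribution at `v`.
    in k , ≈-trans (opposite (b i))
           (≈-trans (≈-sym (inverseʳ-unique (φ (b i , false)) _ (flow (u i))))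
           (≈-trans loops≈ commutator≈))

  double-step : ∀ i → IsDoubleStep (φ (b i , true))
  double-step i = small-even
    (contribution-preserves 𝔻 Γ {P = 𝔻^< 3} (λ {g} → 𝔻^<-⁻¹ g) o f (b i , true) (f<3 (b i)))
    (contribution-preserves 𝔻 Γ {P = λ g → ¬ g ≈ 1𝔻} ≉1-⁻¹ o f (b i , true) (f≉1 (b i)))
    (even i)

mainTheorem1 : AdmitsNowhereIdentityFlow D[2· 3 ] Γ
    × ¬ AdmitsNowhereIdentityDihedralFlow 3 Γ
    × ¬ (∀ (Δ : EmbeddedGraph) →
    AdmitsNowhereIdentityFlow D[2· 3 ] Δ ⇔ AdmitsNowhereIdentityDihedralFlow 3 Δ)
mainTheorem1 = D₆-flow , no-dihedral-3-flow ,
  λ equivalent → no-dihedral-3-flow (Equivalence.to (equivalent Γ) D₆-flow)
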